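{- Let $g\ge 0$, $r\ge 1$ and $d$ be integers with $d\ge g+r$. Then the number of $L$-tableaux with parameters $(g,r,d)$ is $(r+1)^g$.
   Context: Young diagrams are drawn in the French convention (left- and bottom-justified, with the longest row at the bottom). An $L$-tableau with parameters $(g,r,d)$ is a filling of all boxes of a grid with $r+1$ rows and $d-r$ columns with $rg$ "red" integers and $(d-r)(r+1)-rg$ "blue" integers such that: (1) the boxes containing red integers are left-and-bottom justified, i.e. they form the Young diagram of a partition placed in the lower left corner of the grid; the red integers weakly increase from bottom to top up columns and strictly increase from left to right across rows; and they consist of the numbers $1,2,\ldots,g$, each occurring exactly $r$ times; (2) the blue integers occupy the remaining boxes of the grid (hence are right-and-top justified), have values in $\{0,1,\ldots,r\}$ (with any multiplicities), strictly increase from bottom to top up columns, and weakly increase from left to right across rows. There is no order condition between red and blue integers. -}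

module Defs where

open import Data.Fin using (Fin; _≤_; _<_; _≟_)
open import Data.List using (List; length; filter; allFin; cartesianProduct)
open import Data.Nat using (ℕ; suc; _*_; _∸_)
open import Data.Product using (Σ; _×_; _,_; ∃-syntax; proj₁)
open import Function.Bundles using (Bijection)
open import Level using (0ℓ; _⊔_)
open import Relation.Binary.Bundles using (Setoid)
open import Relation.Binary.PropositionalEquality using (_≡_; refl; sym; trans; cong; setoid)
open import Relation.Nullary using (yes; no)
open import Relation.Nullary.Decidable using (map′)
open import Relation.Unary using (Pred; Decidable)

-- `red k` with k : Fin g stands for the red integer toℕ k + 1 ∈ {1,…,g};
-- `blue c` with c : Fin (suc r) stands for the blue integer toℕ c ∈ {0,…,r}.
data Entry (g r : ℕ) : Set where
  red  : Fin g → Entry g r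
  blue : Fin (suc r) → Entry g r

module _ {g r : ℕ} where

  IsRed IsBlue : Pred (Entry g r) 0ℓ
  IsRed  e = ∃[ k ] e ≡ red k
  IsBlue e = ∃[ c ] e ≡ blue c

  isRed? : Decidable IsRed
  isRed? (red k)  = yes (k , refl)
  isRed? (blue _) = no λ ()

  isBlue? : Decidable IsBlue
  isBlue? (red _)  = no λ ()
  isBlue? (blue c) = yes (c , refl)

  ≡red? : (k : Fin g) → Decidable {A = Entry g r} (_≡ red k)
  ≡red? k (red l)  = map′ (cong red) (λ { refl → refl }) (l ≟ k)
  ≡red? k (blue _) = no λ ()

-- `T i j` is the entry in row i, counted from the bottom, and column j,
-- counted from the left.
Filling : (g r m n : ℕ) → Set
Filling g r m n = Fin m → Fin n → Entry g r

boxes : (m n : ℕ) → List (Fin m × Fin n)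
boxes m n = cartesianProduct (allFin m) (allFin n)

#boxes : ∀ {g r m n} {P : Pred (Entry g r) 0ℓ} →
         Decidable P → Filling g r m n → ℕ
#boxes {m = m} {n = n} P? T =
  length (filter (λ { (i , j) → P? (T i j) }) (boxes m n))

-- Row length d - r and the blue count (d - r)(r + 1) - rg are nonnegative when
-- g + r ≤ d, so truncated subtraction is harmless there.
record IsLTableau (g r d : ℕ) (T : Filling g r (suc r) (d ∸ r)) : Set where
  field
    #red  : #boxes isRed?  T ≡ r * g
    #blue : #boxes isBlue? T ≡ (d ∸ r) * suc r ∸ r * g

    -- The red boxes form a Young diagram in the lower left corner.
    red-justified  : ∀ {i i′ j j′} → i′ ≤ i → j′ ≤ j →
                     IsRed (T i j) → IsRed (T i′ j′)
    red-columns    : ∀ {i i′ j k l} → i < i′ →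
                     T i j ≡ red k → T i′ j ≡ red l → k ≤ l
    red-rows       : ∀ {i j j′ k l} → j < j′ →
                     T i j ≡ red k → T i j′ ≡ red l → k < l
    red-content    : ∀ k → #boxes (≡red? k) T ≡ r

    blue-columns   : ∀ {i i′ j a b} → i < i′ →
                     T i j ≡ blue a → T i′ j ≡ blue b → a < b
    blue-rows      : ∀ {i j j′ a b} → j < j′ →
                     T i j ≡ blue a → T i j′ ≡ blue b → a ≤ b

-- L-tableaux are compared through their entries only.
LTableau : (g r d : ℕ) → Setoid 0ℓ 0ℓ
LTableau g r d = record
  { Carrier       = Σ (Filling g r (suc r) (d ∸ r)) (IsLTableau g r d)
  ; _≈_           = λ S T → ∀ i j → proj₁ S i j ≡ proj₁ T i j
  ; isEquivalence = record
    { refl  = λ _ _ → refl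
    ; sym   = λ p i j → sym (p i j)
    ; trans = λ p q i j → trans (p i j) (q i j)
    }
  }

HasCardinality : ∀ {a ℓ} → Setoid a ℓ → ℕ → Set (a ⊔ ℓ)
HasCardinality S n = Bijection (setoid (Fin n)) S

{-# OPTIONS --safe #-}
module Submission where

-- Order the letters as red 1 < … < red g < blue 0 < … < blue r and let M ℓ i be
-- the number of boxes of row i whose letter has at least ℓ letters below it. Each
-- red letter occurs at most once per row, so it misses exactly one of the r + 1 rows;
-- hence subtracting from M ℓ the g - ℓ red letters still to come leaves a weakly
-- increasing vector that grows by a unit vector at each red letter. The blue
-- letters then form a Gelfand–Tsetlin pattern. Starting from the constant vector
-- d - r - g, the number of such chains is (r + 1)^g, by Pieri's rule
--   Σ_w #GT (c + e_w) = (r + 1) · #GT c,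
-- which is proved by induction on the length of c: for fixed ν and c, the w with
-- ν ≺ c + e_w correspond to the ways of having ν ≺ c or ν - e_i ≺ c.

open import Data.Bool using (Bool; true; false; if_then_else_)
open import Data.Empty using (⊥-elim)
open import Data.Fin as Fin using (Fin; zero; suc; inject₁; toℕ; fromℕ<)
import Data.Fin.Properties as Finₚ
open import Data.Fin.Properties using (toℕ-injective; toℕ<n; toℕ-inject₁; toℕ-fromℕ<; *↔×; _≟_)
open import Data.List as List using (List; length; filter; cartesianProduct; map; _++_)
open import Data.Nat using (ℕ; zero; suc; _+_; _*_; _∸_; _^_; _≤_; _<_; _≤?_; _<?_; z≤n; s≤s)
open import Data.Nat.Properties hiding (_≟_)
open import Data.Product using (Σ; ∃; _×_; _,_; proj₁; proj₂)
open import Data.Product.Function.Dependent.Propositional using () renaming (congˡ to Σ-congˡ)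
open import Data.Product.Function.NonDependent.Propositional using (_×-cong_)
open import Data.Sum using (_⊎_; inj₁; inj₂)
open import Data.Sum.Function.Propositional using (_⊎-cong_)
open import Data.Unit using (⊤; tt)
open import Data.Vec using (Vec; []; _∷_; head; lookup; replicate; tabulate; updateAt)
open import Data.Vec.Properties
  using (lookup∘updateAt; lookup∘updateAt′; lookup∘tabulate; tabulate∘lookup; tabulate-cong; lookup-replicate)
open import Data.Vec.Relation.Unary.Linked as Linked using (Linked; []; [-]; _∷_)
open import Data.Vec.Relation.Unary.Linked.Properties using (lookup⁺)
open import Function using (_∘_; id)
open import Function.Bundles using (_↔_; mk↔ₛ′; _⇔_; mk⇔; Equivalence; Injection; Inverse)
open import Function.Properties.Inverse using (↔-refl; ↔-sym; ↔-trans; Inverse⇒Injection)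
open import Function.Related.Propositional using (module EquationalReasoning)
open import Level using (0ℓ)
open import Relation.Binary.Definitions using (tri<; tri≈; tri>)
open import Relation.Binary.PropositionalEquality
  using (_≡_; _≢_; refl; sym; trans; cong; cong₂; subst; subst₂; module ≡-Reasoning)
open import Relation.Nullary using (¬_; Dec; contradiction; yes; no; does)
open import Relation.Nullary.Decidable using (dec-true; dec-false)
open import Relation.Unary using (Pred; Decidable)
open import Algebra.Properties.CommutativeMonoid.Sum +-0-commutativeMonoid
  using (sum; ∑-distrib-+; ∑-comm; sum-cong-≗)
open import Defs

private variable
  g m n r : ℕ

-- Gelfand–Tsetlin patterns and Pieri's rule

Increasing : Vec ℕ m → Set
Increasing = Linked _≤_

bump : Vec ℕ m → Fin m → Vec ℕ m
bump c w = updateAt c w suc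

infix 4 _≺_
-- Interlacing of consecutive rows of a Gelfand-Tsetlin pattern, x_0 ≤ y_0 ≤ x_1 ≤ ... ≤ x_m, read
-- in increasing order.
data _≺_ : Vec ℕ m → Vec ℕ (suc m) → Set where
  [] : ∀ {x} → [] ≺ x ∷ []
  interlace : ∀ {x y} {ys : Vec ℕ m} {xs : Vec ℕ (suc m)} →
              x ≤ y → y ≤ head xs → ys ≺ xs → y ∷ ys ≺ x ∷ xs

≺-irrelevant : {ν : Vec ℕ m} {c : Vec ℕ (suc m)} (p q : ν ≺ c) → p ≡ q
≺-irrelevant [] [] = refl
≺-irrelevant (interlace p q r) (interlace p′ q′ r′)
  rewrite ≤-irrelevant p p′ | ≤-irrelevant q q′ | ≺-irrelevant r r′ = refl

Increasing-irrelevant : {c : Vec ℕ m} (p q : Increasing c) → p ≡ q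
Increasing-irrelevant = Linked.irrelevant ≤-irrelevant

≺⇒increasingʳ : {ν : Vec ℕ m} {c : Vec ℕ (suc m)} → ν ≺ c → Increasing c
≺⇒increasingʳ [] = [-]
≺⇒increasingʳ (interlace p q r) = ≤-trans p q ∷ ≺⇒increasingʳ r

≺⇒increasingˡ : {ν : Vec ℕ m} {c : Vec ℕ (suc m)} → ν ≺ c → Increasing ν
≺⇒increasingˡ [] = []
≺⇒increasingˡ (interlace p q []) = [-]
≺⇒increasingˡ (interlace p q r@(interlace p′ _ _)) = ≤-trans q p′ ∷ ≺⇒increasingˡ r

head≤head-bump : (c : Vec ℕ (suc m)) (w : Fin (suc m)) → head c ≤ head (bump c w)
head≤head-bump (x ∷ c) zero = n≤1+n x
head≤head-bump (x ∷ c) (suc w) = ≤-refl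

GrowsAbove : Vec ℕ m → Vec ℕ (suc m) → Set
GrowsAbove {m} ν c = Σ (Fin (suc m)) λ w → ν ≺ bump c w

-- Stands for `ν′` minus a unit vector interlacing with `c`; the equation `bump ν i ≡ ν′` avoids
-- truncated subtraction and lets matching on `refl` eliminate `ν′`.
ShrinksBelow : Vec ℕ m → Vec ℕ (suc m) → Set
ShrinksBelow {m} ν′ c = Σ (Fin m) λ i → Σ (Vec ℕ m) λ ν → ν ≺ c × bump ν i ≡ ν′

module _ {x y : ℕ} {ys : Vec ℕ m} {xs : Vec ℕ (suc m)} where

  -- While `y ≤ head xs`, no bump of `xs` can break the upper bound on `y`, so the first position
  -- separates from the tail: a bump there only costs `x < y`.
  grows-within : y ≤ head xs →
    GrowsAbove (y ∷ ys) (x ∷ xs) ↔ (x < y × ys ≺ xs ⊎ x ≤ y × GrowsAbove ys xs)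
  grows-within y≤ = mk↔ₛ′ to from to∘from from∘to
    where
    to : GrowsAbove (y ∷ ys) (x ∷ xs) → x < y × ys ≺ xs ⊎ x ≤ y × GrowsAbove ys xs
    to (zero  , interlace p _ r) = inj₁ (p , r)
    to (suc w , interlace p _ r) = inj₂ (p , w , r)
    from : x < y × ys ≺ xs ⊎ x ≤ y × GrowsAbove ys xs → GrowsAbove (y ∷ ys) (x ∷ xs)
    from (inj₁ (p , r))     = zero , interlace p y≤ r
    from (inj₂ (p , w , r)) = suc w , interlace p (≤-trans y≤ (head≤head-bump xs w)) r
    to∘from : ∀ b → to (from b) ≡ b
    to∘from (inj₁ _) = refl
    to∘from (inj₂ _) = refl
    from∘to : ∀ a → from (to a) ≡ a
    from∘to (zero  , interlace _ _ _) = cong (zero ,_) (≺-irrelevant _ _)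
    from∘to (suc w , interlace _ _ _) = cong (suc w ,_) (≺-irrelevant _ _)

  -- Takes the same shape as `grows-within`: lowering `y` while staying at or above `x` means
  -- `x < y`, and the other two options leave `y` alone. The tails then match by induction.
  shrinks-within : y ≤ head xs →
    (y ∷ ys ≺ x ∷ xs ⊎ ShrinksBelow (y ∷ ys) (x ∷ xs))
      ↔ (x < y × ys ≺ xs ⊎ x ≤ y × (ys ≺ xs ⊎ ShrinksBelow ys xs))
  shrinks-within y≤ = mk↔ₛ′ to from to∘from from∘to
    where
    to : (y ∷ ys ≺ x ∷ xs ⊎ ShrinksBelow (y ∷ ys) (x ∷ xs)) →
         (x < y × ys ≺ xs ⊎ x ≤ y × (ys ≺ xs ⊎ ShrinksBelow ys xs))
    to (inj₁ (interlace p _ r)) = inj₂ (p , inj₁ r)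
    to (inj₂ (zero  , _ , interlace p _ r , refl)) = inj₁ (s≤s p , r)
    to (inj₂ (suc i , _ , interlace p _ r , refl)) = inj₂ (p , inj₂ (i , _ , r , refl))
    from : (x < y × ys ≺ xs ⊎ x ≤ y × (ys ≺ xs ⊎ ShrinksBelow ys xs)) →
           (y ∷ ys ≺ x ∷ xs ⊎ ShrinksBelow (y ∷ ys) (x ∷ xs))
    from (inj₁ (s≤s p , r)) =
      inj₂ (zero , _ , interlace p (≤-trans (n≤1+n _) y≤) r , refl)
    from (inj₂ (p , inj₁ r)) = inj₁ (interlace p y≤ r)
    from (inj₂ (p , inj₂ (i , _ , r , refl))) =
      inj₂ (suc i , _ , interlace p y≤ r , refl)
    to∘from : ∀ b → to (from b) ≡ b
    to∘from (inj₁ (s≤s _ , _)) = refl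
    to∘from (inj₂ (_ , inj₁ _)) = refl
    to∘from (inj₂ (_ , inj₂ (_ , _ , _ , refl))) = refl
    from∘to : ∀ a → from (to a) ≡ a
    from∘to (inj₁ (interlace _ _ _)) = cong inj₁ (≺-irrelevant _ _)
    from∘to (inj₂ (zero  , ν , interlace _ _ _ , refl)) =
      cong (λ p → inj₂ (zero , ν , p , refl)) (≺-irrelevant _ _)
    from∘to (inj₂ (suc i , ν , interlace _ _ _ , refl)) =
      cong (λ p → inj₂ (suc i , ν , p , refl)) (≺-irrelevant _ _)

  -- A unit change closes a gap of at most one between `head xs` and `y`, so both sides are empty.
  none-beyond : suc (head xs) < y →
    GrowsAbove (y ∷ ys) (x ∷ xs) ↔ (y ∷ ys ≺ x ∷ xs ⊎ ShrinksBelow (y ∷ ys) (x ∷ xs))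
  none-beyond y> = mk↔ₛ′ (⊥-elim ∘ noA) (⊥-elim ∘ noB) (⊥-elim ∘ noB) (⊥-elim ∘ noA)
    where
    head-bump≤ : ∀ {n} (c : Vec ℕ (suc n)) w → head (bump c w) ≤ suc (head c)
    head-bump≤ (_ ∷ _) zero    = ≤-refl
    head-bump≤ (_ ∷ _) (suc _) = n≤1+n _
    noA : ¬ GrowsAbove (y ∷ ys) (x ∷ xs)
    noA (zero  , interlace _ q _) = <⇒≱ y> (≤-trans q (n≤1+n _))
    noA (suc w , interlace _ q _) = <⇒≱ y> (≤-trans q (head-bump≤ xs w))
    noB : ¬ (y ∷ ys ≺ x ∷ xs ⊎ ShrinksBelow (y ∷ ys) (x ∷ xs))
    noB (inj₁ (interlace _ q _)) = <⇒≱ y> (≤-trans q (n≤1+n _))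
    noB (inj₂ (zero  , _ , interlace _ q _ , refl)) = <⇒≱ y> (s≤s q)
    noB (inj₂ (suc _ , _ , interlace _ q _ , refl)) = <⇒≱ y> (≤-trans q (n≤1+n _))

≺-raise-head : ∀ {x} {ν c : Vec ℕ m} → Increasing (suc x ∷ ν) → ν ≺ x ∷ c → ν ≺ suc x ∷ c
≺-raise-head _       []                = []
≺-raise-head (p ∷ _) (interlace _ q r) = interlace p q r

≺-lower-head : ∀ {x} {ν c : Vec ℕ m} → ν ≺ suc x ∷ c → ν ≺ x ∷ c
≺-lower-head []                = []
≺-lower-head (interlace p q r) = interlace (<⇒≤ p) q r

module _ {x x₁ : ℕ} {ys xs : Vec ℕ m} where

  -- Here the first entry exceeds `x₁` by exactly one, so only the bump of `x₁` restores
  -- interlacing. It puts no new constraint on `ys`, whose entries are already at least `suc x₁` by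
  -- monotonicity.
  grows-at-edge : x ≤ x₁ → Increasing (suc x₁ ∷ ys) →
    GrowsAbove (suc x₁ ∷ ys) (x ∷ x₁ ∷ xs) ↔ ys ≺ x₁ ∷ xs
  grows-at-edge x≤ inc = mk↔ₛ′ to from (λ _ → ≺-irrelevant _ _) from∘to
    where
    to : GrowsAbove (suc x₁ ∷ ys) (x ∷ x₁ ∷ xs) → ys ≺ x₁ ∷ xs
    to (zero        , interlace _ q _) = contradiction q 1+n≰n
    to (suc zero    , interlace _ _ r) = ≺-lower-head r
    to (suc (suc _) , interlace _ q _) = contradiction q 1+n≰n
    from : ys ≺ x₁ ∷ xs → GrowsAbove (suc x₁ ∷ ys) (x ∷ x₁ ∷ xs)
    from r = suc zero , interlace (m≤n⇒m≤1+n x≤) ≤-refl (≺-raise-head inc r)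
    from∘to : ∀ a → from (to a) ≡ a
    from∘to (zero        , interlace _ q _) = contradiction q 1+n≰n
    from∘to (suc zero    , interlace _ _ _) = cong (suc zero ,_) (≺-irrelevant _ _)
    from∘to (suc (suc _) , interlace _ q _) = contradiction q 1+n≰n

  -- The first entry is too large by one, so lowering it to `x₁` is the only option.
  shrinks-at-edge : x ≤ x₁ →
    (suc x₁ ∷ ys ≺ x ∷ x₁ ∷ xs ⊎ ShrinksBelow (suc x₁ ∷ ys) (x ∷ x₁ ∷ xs)) ↔ ys ≺ x₁ ∷ xs
  shrinks-at-edge x≤ = mk↔ₛ′ to from (λ _ → ≺-irrelevant _ _) from∘to
    where
    to : (suc x₁ ∷ ys ≺ x ∷ x₁ ∷ xs ⊎ ShrinksBelow (suc x₁ ∷ ys) (x ∷ x₁ ∷ xs)) → ys ≺ x₁ ∷ xs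
    to (inj₁ (interlace _ q _)) = contradiction q 1+n≰n
    to (inj₂ (zero  , _ , interlace _ _ r , refl)) = r
    to (inj₂ (suc _ , _ , interlace _ q _ , refl)) = contradiction q 1+n≰n
    from : ys ≺ x₁ ∷ xs → (suc x₁ ∷ ys ≺ x ∷ x₁ ∷ xs ⊎ ShrinksBelow (suc x₁ ∷ ys) (x ∷ x₁ ∷ xs))
    from r = inj₂ (zero , _ , interlace x≤ ≤-refl r , refl)
    from∘to : ∀ a → from (to a) ≡ a
    from∘to (inj₁ (interlace _ q _)) = contradiction q 1+n≰n
    from∘to (inj₂ (zero  , ν , interlace _ _ _ , refl)) =
      cong (λ p → inj₂ (zero , ν , p , refl)) (≺-irrelevant _ _)
    from∘to (inj₂ (suc _ , _ , interlace _ q _ , refl)) = contradiction q 1+n≰n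

-- Compares `y` with `suc x₁`: below it the tails are matched by induction, at it both sides reduce
-- to the same interlacing, above it both are empty. The summand `ν ≺ c` accounts for `c` having one
-- position more than `ν`.
local-rule : (ν : Vec ℕ m) (c : Vec ℕ (suc m)) → Increasing ν → Increasing c →
             GrowsAbove ν c ↔ (ν ≺ c ⊎ ShrinksBelow ν c)
local-rule [] (x ∷ []) _ _ = mk↔ₛ′
  (λ _ → inj₁ []) (λ _ → zero , [])
  (λ { (inj₁ []) → refl }) (λ { (zero , []) → refl })
local-rule (y ∷ ys) (x ∷ x₁ ∷ xs) incν (x≤x₁ ∷ incc) with <-cmp y (suc x₁)
... | tri< (s≤s y≤x₁) _ _ =
  ↔-trans (grows-within y≤x₁)
    (↔-trans (↔-refl ⊎-cong (↔-refl ×-cong local-rule ys (x₁ ∷ xs) (Linked.tail incν) incc))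
      (↔-sym (shrinks-within y≤x₁)))
... | tri≈ _ refl _ = ↔-trans (grows-at-edge x≤x₁ incν) (↔-sym (shrinks-at-edge x≤x₁))
... | tri> _ _ y>   = none-beyond y>

-- Only the first vector is a parameter; for a tableau, level ℓ of the pattern lists
-- the number of blue letters ≥ ℓ in rows ℓ, …, r, the rows below having none.
GT : Vec ℕ m → Set
GT {zero}  _ = ⊤
GT {suc m} c = Σ (Vec ℕ m) λ ν → ν ≺ c × GT ν

GT⇒increasing : (c : Vec ℕ m) → GT c → Increasing c
GT⇒increasing []      _           = []
GT⇒increasing (_ ∷ _) (_ , r , _) = ≺⇒increasingʳ r

-- Choosing `ν` before `w` makes `local-rule` applicable. Its summand `ν ≺ c` gives one copy of
-- `GT c`; the other gives one copy for each position of `ν`, by induction on the rows below.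
pieri : (c : Vec ℕ m) → Increasing c → (Σ (Fin m) λ w → GT (bump c w)) ↔ (Fin m × GT c)
pieri {zero} c _ = mk↔ₛ′ (λ ()) (λ ()) (λ ()) (λ ())
pieri {suc m} c inc = begin
  (Σ (Fin (suc m)) λ w → Σ (Vec ℕ m) λ ν → ν ≺ bump c w × GT ν)
    ↔⟨ mk↔ₛ′ (λ (w , ν , p , t) → ν , t , w , p) (λ (ν , t , w , p) → w , ν , p , t)
         (λ _ → refl) (λ _ → refl) ⟩
  (Σ (Vec ℕ m) λ ν → Σ (GT ν) λ _ → GrowsAbove ν c)
    ↔⟨ Σ-congˡ (λ {ν} → Σ-congˡ λ {t} → local-rule ν c (GT⇒increasing ν t) inc) ⟩
  (Σ (Vec ℕ m) λ ν → Σ (GT ν) λ _ → (ν ≺ c ⊎ ShrinksBelow ν c))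
    -- In the second summand the outer vector is `bump ν i`, so its equation eliminates it and
    -- leaves a sum over `ν ≺ c` and `i`.
    ↔⟨ mk↔ₛ′
         (λ { (ν , t , inj₁ r) → inj₁ (ν , r , t)
            ; (_ , t , inj₂ (i , ν , r , refl)) → inj₂ (ν , r , i , t) })
         (λ { (inj₁ (ν , r , t)) → ν , t , inj₁ r
            ; (inj₂ (ν , r , i , t)) → _ , t , inj₂ (i , ν , r , refl) })
         (λ { (inj₁ _) → refl ; (inj₂ _) → refl })
         (λ { (_ , _ , inj₁ _) → refl ; (_ , _ , inj₂ (_ , _ , _ , refl)) → refl }) ⟩
  (GT c ⊎ (Σ (Vec ℕ m) λ ν → Σ (ν ≺ c) λ _ → Σ (Fin m) λ i → GT (bump ν i)))
    ↔⟨ ↔-refl ⊎-cong Σ-congˡ (λ {ν} → Σ-congˡ λ {r} → pieri ν (≺⇒increasingˡ r)) ⟩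
  (GT c ⊎ (Σ (Vec ℕ m) λ ν → Σ (ν ≺ c) λ _ → Fin m × GT ν))
    ↔⟨ mk↔ₛ′
         (λ { (inj₁ t) → zero , t ; (inj₂ (ν , r , i , t)) → suc i , ν , r , t })
         (λ { (zero , t) → inj₁ t ; (suc i , ν , r , t) → inj₂ (ν , r , i , t) })
         (λ { (zero , _) → refl ; (suc _ , _) → refl })
         (λ { (inj₁ _) → refl ; (inj₂ _) → refl }) ⟩
  (Fin (suc m) × GT c) ∎
  where open EquationalReasoning

-- The entries w are the rows missed by the red letters, in increasing order of
-- the letters; keeping the vector increasing makes the red columns weakly increase.
Chain : ℕ → Vec ℕ m → Set
Chain     zero    c = GT c
Chain {m} (suc k) c = Σ (Fin m) λ w → Increasing (bump c w) × Chain k (bump c w)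

chain-count : (k : ℕ) (c : Vec ℕ m) → Increasing c → Chain k c ↔ (Fin (m ^ k) × GT c)
chain-count zero c _ = mk↔ₛ′ (zero ,_) proj₂ (λ { (zero , _) → refl }) (λ _ → refl)
chain-count {m} (suc k) c inc = begin
  (Σ (Fin m) λ w → Σ (Increasing (bump c w)) λ _ → Chain k (bump c w))
    ↔⟨ Σ-congˡ (λ {w} → Σ-congˡ λ {p} → chain-count k (bump c w) p) ⟩
  (Σ (Fin m) λ w → Σ (Increasing (bump c w)) λ _ → Fin (m ^ k) × GT (bump c w))
    ↔⟨ mk↔ₛ′ (λ (w , _ , q , t) → q , w , t)
         (λ (q , w , t) → w , GT⇒increasing _ t , q , t)
         (λ _ → refl)
         (λ (w , _ , q , t) → cong (λ p → w , p , q , t) (Increasing-irrelevant _ _)) ⟩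
  (Fin (m ^ k) × (Σ (Fin m) λ w → GT (bump c w)))
    ↔⟨ ↔-refl ×-cong pieri c inc ⟩
  (Fin (m ^ k) × (Fin m × GT c))
    ↔⟨ mk↔ₛ′ (λ (q , w , t) → (w , q) , t) (λ ((w , q) , t) → q , w , t)
         (λ _ → refl) (λ _ → refl) ⟩
  ((Fin m × Fin (m ^ k)) × GT c)
    ↔⟨ ↔-sym *↔× ×-cong ↔-refl ⟩
  (Fin (m ^ suc k) × GT c) ∎
  where open EquationalReasoning

-- Chains as profiles

lookup-mono : {c : Vec ℕ m} → Increasing c → ∀ {i i′} → i Fin.≤ i′ → lookup c i ≤ lookup c i′
lookup-mono {c = c} inc i≤i′ with m≤n⇒m<n∨m≡n i≤i′
... | inj₁ i<i′ = lookup⁺ ≤-trans inc i<i′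
... | inj₂ i≡i′ = ≤-reflexive (cong (lookup c) (toℕ-injective i≡i′))

lookup-mono⁻ : (c : Vec ℕ m) → (∀ {i i′} → i Fin.≤ i′ → lookup c i ≤ lookup c i′) → Increasing c
lookup-mono⁻ []           _    = []
lookup-mono⁻ (_ ∷ [])     _    = [-]
lookup-mono⁻ (_ ∷ _ ∷ _)  mono =
  mono {zero} {suc zero} z≤n ∷ lookup-mono⁻ _ (λ i≤i′ → mono {suc _} {suc _} (s≤s i≤i′))

lookup-injective : {c c′ : Vec ℕ m} → (∀ i → lookup c i ≡ lookup c′ i) → c ≡ c′
lookup-injective {c = c} {c′} eq =
  trans (sym (tabulate∘lookup c)) (trans (tabulate-cong eq) (tabulate∘lookup c′))

bump-injective : (c : Vec ℕ m) {w w′ : Fin m} →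
                 (∀ i → lookup (bump c w) i ≡ lookup (bump c w′) i) → w ≡ w′
bump-injective c {w} {w′} eq with w ≟ w′
... | yes w≡w′ = w≡w′
... | no  w≢w′ = contradiction
  (trans (sym (lookup∘updateAt w c)) (trans (eq w) (lookup∘updateAt′ w w′ w≢w′ c))) 1+n≢n

≺-lower : {ν : Vec ℕ m} {c : Vec ℕ (suc m)} → ν ≺ c → ∀ i → lookup c (inject₁ i) ≤ lookup ν i
≺-lower (interlace p _ _) zero    = p
≺-lower (interlace _ _ r) (suc i) = ≺-lower r i

≺-upper : {ν : Vec ℕ m} {c : Vec ℕ (suc m)} → ν ≺ c → ∀ i → lookup ν i ≤ lookup c (suc i)
≺-upper {c = _ ∷ _ ∷ _} (interlace _ q _) zero    = q
≺-upper                 (interlace _ _ r) (suc i) = ≺-upper r i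

≺-intro : (ν : Vec ℕ m) (c : Vec ℕ (suc m)) → (∀ i → lookup c (inject₁ i) ≤ lookup ν i) →
          (∀ i → lookup ν i ≤ lookup c (suc i)) → ν ≺ c
≺-intro []       (_ ∷ [])    _ _ = []
≺-intro (_ ∷ ν)  (_ ∷ c@(_ ∷ _)) l u = interlace (l zero) (u zero) (≺-intro ν c (l ∘ suc) (u ∘ suc))

GT-constant : (κ : ℕ) → GT (replicate m κ)
GT-constant {zero}  κ = tt
GT-constant {suc m} κ =
  replicate m κ , ≺-intro _ _ (λ i → lemma (inject₁ i) i) (λ i → lemma i (suc i)) , GT-constant κ
  where
  lemma : ∀ {a b} (i : Fin a) (j : Fin b) → lookup (replicate a κ) i ≤ lookup (replicate b κ) j
  lemma i j = ≤-reflexive (trans (lookup-replicate i κ) (sym (lookup-replicate j κ)))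

≺-constant : ∀ κ {ν : Vec ℕ m} → ν ≺ replicate (suc m) κ → ν ≡ replicate m κ
≺-constant κ r = lookup-injective λ i → trans
  (≤-antisym
    (≤-trans (≺-upper r i) (≤-reflexive (lookup-replicate (suc i) κ)))
    (≤-trans (≤-reflexive (sym (lookup-replicate (inject₁ i) κ))) (≺-lower r i)))
  (sym (lookup-replicate i κ))

-- Interlacing with a constant vector forces every row below to be constant, so a chain starting
-- there carries a `GT` factor of one.
GT-constant-unique : (κ : ℕ) (t t′ : GT (replicate m κ)) → t ≡ t′
GT-constant-unique {zero}  κ _ _ = refl
GT-constant-unique {suc m} κ (ν , r , t) (ν′ , r′ , t′)
  with refl ← ≺-constant κ r | refl ← ≺-constant κ r′ =
  cong₂ (λ r t → replicate m κ , r , t) (≺-irrelevant r r′) (GT-constant-unique κ t t′)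

-- Says when `M ℓ i` can count the letters of rank at least `ℓ` in row `i`. By `red-step` a red
-- letter occurs once in every row but `w`; `red-increasing` gives weakly increasing red columns
-- and, at `ℓ = g`, the Young diagram shape; the shift of level in `blue-increasing` makes blue
-- columns strict.
record IsProfile (g : ℕ) (M : ℕ → Fin m → ℕ) : Set where
  field
    end             : ∀ i → M (g + m) i ≡ 0
    antitone        : ∀ ℓ i → M (suc ℓ) i ≤ M ℓ i
    red-step        : ∀ {ℓ} → ℓ < g → ∃ λ w →
                      M ℓ w ≡ M (suc ℓ) w × (∀ i → i ≢ w → M ℓ i ≡ suc (M (suc ℓ) i))
    red-increasing  : ∀ {ℓ i i′} → ℓ ≤ g → i Fin.≤ i′ → M ℓ i ≤ M ℓ i′
    blue-increasing : ∀ {ℓ i i′} → g ≤ ℓ → i Fin.< i′ → M ℓ i ≤ M (suc ℓ) i′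

open IsProfile

profileGT : (c : Vec ℕ m) → GT c → ℕ → Fin m → ℕ
profileGT         c _           zero    i       = lookup c i
profileGT {suc m} c _           (suc ℓ) zero    = 0
profileGT {suc m} c (ν , _ , t) (suc ℓ) (suc i) = profileGT ν t ℓ i

-- A chain stores counts lowered by the `k` red letters still to come, and `k` is added back here. A
-- row containing the next letter thus keeps its stored entry, and the missed row `w` gains one.
profile : (k : ℕ) (c : Vec ℕ m) → Chain k c → ℕ → Fin m → ℕ
profile zero    c t           ℓ       i = profileGT c t ℓ i
profile (suc k) c _           zero    i = lookup c i + suc k
profile (suc k) c (w , _ , x) (suc ℓ) i = profile k (bump c w) x ℓ i

profile-start : (k : ℕ) (c : Vec ℕ m) (x : Chain k c) (i : Fin m) →
                profile k c x 0 i ≡ lookup c i + k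
profile-start zero    c x i = sym (+-identityʳ _)
profile-start (suc k) c x i = refl

-- The two halves of interlacing are used separately: the upper bound on `ν` gives `antitone`, the
-- lower bound gives `blue-increasing`.
profileGT-isProfile : (c : Vec ℕ m) (t : GT c) → Increasing c → IsProfile 0 (profileGT c t)
profileGT-isProfile {zero} c t _ = record
  { end = λ () ; antitone = λ _ () ; red-step = λ () ; red-increasing = λ { {i = ()} }
  ; blue-increasing = λ { {i = ()} } }
profileGT-isProfile {suc m} c t@(ν , r , s) inc = record
  { end = λ { zero → refl ; (suc i) → end ih i }
  ; antitone = λ { zero zero → z≤n ; zero (suc i) → ≺-upper r i
                 ; (suc ℓ) zero → z≤n ; (suc ℓ) (suc i) → antitone ih ℓ i }
  ; red-step = λ ()
  ; red-increasing = λ { z≤n i≤i′ → lookup-mono inc i≤i′ }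
  ; blue-increasing = λ {ℓ} {i} {i′} _ → shifted ℓ i i′
  }
  where
  ih = profileGT-isProfile ν s (≺⇒increasingˡ r)
  shifted : ∀ ℓ i i′ → i Fin.< i′ → profileGT c t ℓ i ≤ profileGT c t (suc ℓ) i′
  shifted zero i (suc i′) (s≤s i≤i′) =
    ≤-trans (lookup-mono inc (≤-trans i≤i′ (≤-reflexive (sym (toℕ-inject₁ i′)))))
            (≺-lower r i′)
  shifted (suc ℓ) zero    _        _          = z≤n
  shifted (suc ℓ) (suc i) (suc i′) (s≤s i<i′) = blue-increasing ih z≤n i<i′

profile-isProfile : (k : ℕ) (c : Vec ℕ m) (x : Chain k c) → Increasing c → IsProfile k (profile k c x)
profile-isProfile zero    c x inc = profileGT-isProfile c x inc
profile-isProfile (suc k) c (w , incʷ , x) inc = record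
  { end = end ih
  ; antitone = anti
  ; red-step = λ { {zero} _ → w , at-w , off-w ; {suc ℓ} (s≤s ℓ<k) → red-step ih ℓ<k }
  ; red-increasing = λ { {zero} _ i≤i′ → +-monoˡ-≤ (suc k) (lookup-mono inc i≤i′)
                       ; {suc ℓ} (s≤s ℓ≤k) i≤i′ → red-increasing ih ℓ≤k i≤i′ }
  ; blue-increasing = λ { (s≤s k≤ℓ) i<i′ → blue-increasing ih k≤ℓ i<i′ }
  }
  where
  ih = profile-isProfile k (bump c w) x incʷ
  at-w : lookup c w + suc k ≡ profile k (bump c w) x 0 w
  at-w rewrite profile-start k (bump c w) x w | lookup∘updateAt w {suc} c = +-suc _ k
  off-w : ∀ i → i ≢ w → lookup c i + suc k ≡ suc (profile k (bump c w) x 0 i)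
  off-w i i≢w rewrite profile-start k (bump c w) x i | lookup∘updateAt′ i w {suc} i≢w c = +-suc _ k
  anti : ∀ ℓ i → profile k (bump c w) x ℓ i ≤ profile (suc k) c (w , incʷ , x) ℓ i
  anti zero i with i ≟ w
  ... | yes refl = ≤-reflexive (sym at-w)
  ... | no  i≢w  = ≤-trans (n≤1+n _) (≤-reflexive (sym (off-w i i≢w)))
  anti (suc ℓ) i = antitone ih ℓ i

-- Blue columns are strict and there are as many rows as blue letters, so the bottom row can contain
-- only the letter 0. Formally, moving up one row and one level reduces to a grid with one row less,
-- down to `end`.
corner-zero : {M : ℕ → Fin (suc m) → ℕ} → IsProfile 0 M → ∀ ℓ → M (suc ℓ) zero ≡ 0
sub-profile : {M : ℕ → Fin (suc m) → ℕ} → IsProfile 0 M → IsProfile 0 (λ ℓ i → M (suc ℓ) (suc i))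

sub-profile pr = record
  { end = λ i → end pr (suc i)
  ; antitone = λ ℓ i → antitone pr (suc ℓ) (suc i)
  ; red-step = λ ()
  ; red-increasing = λ { {i = i} {i′} z≤n i≤i′ → sub-inc i i′ i≤i′ }
  ; blue-increasing = λ _ i<i′ → blue-increasing pr z≤n (s≤s i<i′)
  }
  where
  sub-inc : ∀ i i′ → i Fin.≤ i′ → _
  sub-inc i i′ i≤i′ with m≤n⇒m<n∨m≡n i≤i′
  ... | inj₁ i<i′ = ≤-trans (blue-increasing pr z≤n (s≤s i<i′)) (antitone pr _ _)
  ... | inj₂ i≡i′ rewrite toℕ-injective i≡i′ = ≤-refl

corner-zero {zero}  pr zero    = end pr zero
corner-zero {suc m} pr zero    = n≤0⇒n≡0 (≤-trans (blue-increasing pr {i′ = suc zero} z≤n (s≤s z≤n))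
  (≤-reflexive (corner-zero (sub-profile pr) zero)))
corner-zero         pr (suc ℓ) =
  n≤0⇒n≡0 (≤-trans (antitone pr _ _) (≤-reflexive (corner-zero pr ℓ)))

profileGT-surjective : (c : Vec ℕ m) {M : ℕ → Fin m → ℕ} → IsProfile 0 M →
  (∀ i → M 0 i ≡ lookup c i) → ∃ λ t → ∀ ℓ i → profileGT c t ℓ i ≡ M ℓ i
profileGT-surjective {zero}  c pr start = tt , λ _ ()
profileGT-surjective {suc m} c {M} pr start =
  (ν , interlaced , proj₁ ih) ,
  λ { zero    i       → sym (start i)
    ; (suc ℓ) zero    → sym (corner-zero pr ℓ)
    ; (suc ℓ) (suc i) → proj₂ ih ℓ i }
  where
  ν = tabulate (λ i → M 1 (suc i))
  ih = profileGT-surjective ν (sub-profile pr) (λ i → sym (lookup∘tabulate _ i))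
  interlaced : ν ≺ c
  interlaced = ≺-intro ν c
    (λ i → ≤-trans (≤-reflexive (sym (start (inject₁ i))))
             (≤-trans (blue-increasing pr z≤n (s≤s (≤-reflexive (toℕ-inject₁ i))))
               (≤-reflexive (sym (lookup∘tabulate _ i)))))
    (λ i → ≤-trans (≤-reflexive (lookup∘tabulate _ i))
             (≤-trans (antitone pr 0 (suc i)) (≤-reflexive (start (suc i)))))

profile-surjective : (k : ℕ) (c : Vec ℕ m) {M : ℕ → Fin m → ℕ} → IsProfile k M →
  (∀ i → M 0 i ≡ lookup c i + k) → ∃ λ x → ∀ ℓ i → profile k c x ℓ i ≡ M ℓ i
profile-surjective zero c pr start =
  profileGT-surjective c pr λ i → trans (start i) (+-identityʳ _)
profile-surjective {m} (suc k) c {M} pr start with red-step pr (s≤s z≤n)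
... | w , at-w , off-w =
  (w , increasing , proj₁ ih) ,
  λ { zero i → sym (start i) ; (suc ℓ) i → proj₂ ih ℓ i }
  where
  next : ∀ i → M 1 i ≡ lookup (bump c w) i + k
  next i with i ≟ w
  ... | yes refl rewrite lookup∘updateAt w {suc} c = trans (sym at-w) (trans (start w) (+-suc _ k))
  ... | no  i≢w  rewrite lookup∘updateAt′ i w {suc} i≢w c =
    suc-injective (trans (sym (off-w i i≢w)) (trans (start i) (+-suc _ k)))
  increasing : Increasing (bump c w)
  -- Adding `k` to each entry yields level 1 of `M`, so monotonicity is inherited from
  -- `red-increasing`.
  increasing = lookup-mono⁻ _ λ {i} {i′} i≤i′ → +-cancelʳ-≤ k _ _
    (≤-trans (≤-reflexive (sym (next i)))
      (≤-trans (red-increasing pr (s≤s z≤n) i≤i′) (≤-reflexive (next i′))))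
  ih = profile-surjective k (bump c w) {λ ℓ → M (suc ℓ)}
    (record { end = end pr ; antitone = λ ℓ → antitone pr (suc ℓ)
            ; red-step = λ ℓ<k → red-step pr (s≤s ℓ<k)
            ; red-increasing = λ ℓ≤k → red-increasing pr (s≤s ℓ≤k)
            ; blue-increasing = λ k≤ℓ → blue-increasing pr (s≤s k≤ℓ) })
    next

profileGT-injective : (c : Vec ℕ m) {t t′ : GT c} →
  (∀ ℓ i → profileGT c t ℓ i ≡ profileGT c t′ ℓ i) → t ≡ t′
profileGT-injective {zero}  c eq = refl
profileGT-injective {suc m} c {ν , r , t} {ν′ , r′ , t′} eq
  with refl ← lookup-injective {c = ν} {ν′} (λ i → eq 1 (suc i)) =
  cong₂ (λ r t → ν , r , t) (≺-irrelevant r r′)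
    (profileGT-injective ν λ ℓ i → eq (suc ℓ) (suc i))

profile-injective : (k : ℕ) (c : Vec ℕ m) {x x′ : Chain k c} →
  (∀ ℓ i → profile k c x ℓ i ≡ profile k c x′ ℓ i) → x ≡ x′
profile-injective zero    c eq = profileGT-injective c eq
profile-injective (suc k) c {w , p , x} {w′ , p′ , x′} eq
  -- Level 1 determines `bump c w`, and hence the missed row `w`.
  with refl ← bump-injective c {w} {w′} (λ i → +-cancelʳ-≡ k _ _
         (trans (sym (profile-start k _ x i)) (trans (eq 1 i) (profile-start k _ x′ i)))) =
  cong₂ (λ p x → w , p , x) (Increasing-irrelevant p p′)
    (profile-injective k (bump c w) λ ℓ → eq (suc ℓ))

-- Counting boxes

𝟙 : Bool → ℕ
𝟙 b = if b then 1 else 0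

count : {P : Pred (Fin n) 0ℓ} → Decidable P → ℕ
count P? = sum λ j → 𝟙 (does (P? j))

𝟙-yes : {P : Set} (P? : Dec P) → P → 𝟙 (does P?) ≡ 1
𝟙-yes P? p = cong 𝟙 (dec-true P? p)

𝟙-no : {P : Set} (P? : Dec P) → ¬ P → 𝟙 (does P?) ≡ 0
𝟙-no P? ¬p = cong 𝟙 (dec-false P? ¬p)

sum-const : ∀ n c → sum {n} (λ _ → c) ≡ n * c
sum-const zero    c = refl
sum-const (suc n) c = cong (c +_) (sum-const n c)

sum≤n : (f : Fin n → ℕ) → (∀ i → f i ≤ 1) → sum f ≤ n
sum≤n {zero}  f f≤1 = z≤n
sum≤n {suc n} f f≤1 = +-mono-≤ (f≤1 zero) (sum≤n (f ∘ suc) (f≤1 ∘ suc))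

sum≡n⇒all-one : (f : Fin n → ℕ) → (∀ i → f i ≤ 1) → sum f ≡ n → ∀ i → f i ≡ 1
sum≡n⇒all-one {suc n} f f≤1 eq i with f zero in f₀ | f≤1 zero
... | zero  | _ = contradiction eq (<⇒≢ (s≤s (sum≤n (f ∘ suc) (f≤1 ∘ suc))))
sum≡n⇒all-one {suc n} f f≤1 eq zero    | suc zero | _ = f₀
sum≡n⇒all-one {suc n} f f≤1 eq (suc i) | suc zero | _ =
  sum≡n⇒all-one (f ∘ suc) (f≤1 ∘ suc) (suc-injective eq) i
sum≡n⇒all-one {suc n} f f≤1 eq i | suc (suc _) | s≤s ()

all-one-except⇒sum : (f : Fin (suc n) → ℕ) (w : Fin (suc n)) → f w ≡ 0 →
                     (∀ i → i ≢ w → f i ≡ 1) → sum f ≡ n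
all-one-except⇒sum {n} f zero fw≡0 f≡1 = cong₂ _+_ fw≡0
  (trans (sum-cong-≗ λ i → f≡1 (suc i) λ ()) (trans (sum-const n 1) (*-identityʳ n)))
all-one-except⇒sum {suc n} f (suc w) fw≡0 f≡1 = cong₂ _+_ (f≡1 zero λ ())
  (all-one-except⇒sum (f ∘ suc) w fw≡0 λ i i≢w → f≡1 (suc i) λ { refl → i≢w refl })

-- If the first value is 0, the others must all be 1; if it is 1, the exception lies in the tail.
sum⇒all-one-except : (f : Fin (suc n) → ℕ) → (∀ i → f i ≤ 1) → sum f ≡ n →
                     ∃ λ w → f w ≡ 0 × (∀ i → i ≢ w → f i ≡ 1)
sum⇒all-one-except {n} f f≤1 eq with f zero in f₀ | f≤1 zero
... | zero | _ = zero , f₀ ,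
  λ { zero 0≢0 → contradiction refl 0≢0
    ; (suc i) _ → sum≡n⇒all-one (f ∘ suc) (f≤1 ∘ suc) eq i }
sum⇒all-one-except {suc n} f f≤1 eq | suc zero | _ =
  let w , fw≡0 , f≡1 = sum⇒all-one-except (f ∘ suc) (f≤1 ∘ suc) (suc-injective eq) in
  suc w , fw≡0 , λ { zero _ → f₀ ; (suc i) i≢w → f≡1 i (i≢w ∘ cong suc) }
sum⇒all-one-except f f≤1 eq | suc (suc _) | s≤s ()

𝟙≤1 : ∀ b → 𝟙 b ≤ 1
𝟙≤1 false = z≤n
𝟙≤1 true  = ≤-refl

count≤n : {P : Pred (Fin n) 0ℓ} (P? : Decidable P) → count P? ≤ n
count≤n P? = sum≤n _ λ j → 𝟙≤1 (does (P? j))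

count-all : {P : Pred (Fin n) 0ℓ} (P? : Decidable P) → (∀ j → P j) → count P? ≡ n
count-all {n} P? all =
  trans (sum-cong-≗ λ j → 𝟙-yes (P? j) (all j)) (trans (sum-const n 1) (*-identityʳ n))

count-none : {P : Pred (Fin n) 0ℓ} (P? : Decidable P) → (∀ j → ¬ P j) → count P? ≡ 0
count-none {n} P? none =
  trans (sum-cong-≗ λ j → 𝟙-no (P? j) (none j)) (trans (sum-const n 0) (*-zeroʳ n))

count≤1 : {P : Pred (Fin n) 0ℓ} (P? : Decidable P) → (∀ {j j′} → P j → P j′ → j ≡ j′) → count P? ≤ 1
count≤1 {zero}  P? unique = z≤n
count≤1 {suc n} P? unique with P? zero
... | yes p = s≤s (≤-reflexive (count-none (P? ∘ suc) λ j q → Finₚ.0≢1+n (unique p q)))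
... | no  _ = count≤1 (P? ∘ suc) λ p q → Finₚ.suc-injective (unique p q)

-- An upward closed subset of `Fin n` is a final segment, whose length is the count.
count-upward : {P : Pred (Fin n) 0ℓ} (P? : Decidable P) → (∀ {i j} → i Fin.≤ j → P i → P j) →
               ∀ j → P j ⇔ n ≤ toℕ j + count P?
count-upward {suc n} {P} P? up j with P? zero
... | yes p = mk⇔ (λ _ → ≤-trans (≤-reflexive (cong suc (sym (count-all (P? ∘ suc) (λ _ → up z≤n p)))))
                           (m≤n+m _ (toℕ j)))
                  (λ _ → up z≤n p)
count-upward {suc n} {P} P? up zero | no ¬p =
  mk⇔ (λ p → contradiction p ¬p) (λ le → contradiction le (<⇒≱ (s≤s (count≤n (P? ∘ suc)))))
count-upward {suc n} {P} P? up (suc j) | no ¬p =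
  let open Equivalence (count-upward (P? ∘ suc) (λ i≤j → up (s≤s i≤j)) j) in
  mk⇔ (λ p → s≤s (to p)) (λ { (s≤s le) → from le })

threshold-≤ : ∀ {t t′} → t ≤ n → (∀ (j : Fin n) → n ≤ toℕ j + t → n ≤ toℕ j + t′) → t ≤ t′
threshold-≤     {t = zero}  _   _   = z≤n
-- The witness is `n ∸ suc t`, the first box of the final segment of length `suc t`, where the
-- premise holds with equality.
threshold-≤ {n} {t = suc t} {t′} t≤n imp = +-cancelˡ-≤ (n ∸ suc t) _ _
  (≤-trans (≤-reflexive (m∸n+n≡m t≤n))
    (subst (λ k → n ≤ k + t′) (toℕ-fromℕ< below)
      (imp (fromℕ< below) (≤-reflexive (sym (trans (cong (_+ suc t) (toℕ-fromℕ< below)) (m∸n+n≡m t≤n)))))))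
  where
  below : n ∸ suc t < n
  below = ∸-monoʳ-< {n} {suc t} {0} (s≤s z≤n) t≤n

-- Searches downwards from `L` for the greatest level at which `P` holds; this turns the threshold
-- conditions of a box into the rank of its letter.
downward-maximum : (L : ℕ) {P : Pred ℕ 0ℓ} → Decidable P → (∀ {ℓ} → P (suc ℓ) → P ℓ) → P 0 → ¬ P L →
                   ∃ λ v → v < L × (∀ ℓ → ℓ ≤ v ⇔ P ℓ)
downward-maximum zero    P? down p₀ ¬p = contradiction p₀ ¬p
downward-maximum (suc L) {P} P? down p₀ ¬p with P? L
... | yes p  = L , ≤-refl , λ ℓ → mk⇔ (λ le → below le p)
                                   (λ q → ≮⇒≥ λ L<ℓ → ¬p (below L<ℓ q))
  where
  below : ∀ {a b} → a ≤ b → P b → P a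
  below {a} {b} a≤b q with m≤n⇒m<n∨m≡n a≤b
  ... | inj₂ refl = q
  below {a} {suc b} _ q | inj₁ (s≤s a≤b) = below a≤b (down q)
... | no  ¬p′ =
  let v , v<L , char = downward-maximum L P? down p₀ ¬p′ in v , m≤n⇒m≤1+n v<L , char

-- Generalised over `h` and `rest` because removing the first box of a tabulated row composes `h`
-- with `suc`.
length-filter-row : {P : Pred (Fin m × Fin n) 0ℓ} (P? : Decidable P) (i : Fin m)
  {n′ : ℕ} (h : Fin n′ → Fin n) (rest : List (Fin m × Fin n)) →
  length (filter P? (map (i ,_) (List.tabulate h) ++ rest))
    ≡ count (λ j → P? (i , h j)) + length (filter P? rest)
length-filter-row P? i {zero}   h rest = refl
length-filter-row P? i {suc n′} h rest with does (P? (i , h zero))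
... | true  = cong suc (length-filter-row P? i (h ∘ suc) rest)
... | false = length-filter-row P? i (h ∘ suc) rest

length-filter-grid : {P : Pred (Fin m × Fin n) 0ℓ} (P? : Decidable P) {m′ : ℕ} (f : Fin m′ → Fin m) →
  length (filter P? (cartesianProduct (List.tabulate f) (List.allFin n)))
    ≡ sum λ i → count λ j → P? (f i , j)
length-filter-grid P? {zero}   f = refl
length-filter-grid P? {suc m′} f =
  trans (length-filter-row P? (f zero) id _)
        (cong (count (λ j → P? (f zero , j)) +_) (length-filter-grid P? (f ∘ suc)))

#boxes≡sum : {P : Pred (Entry g r) 0ℓ} (P? : Decidable P) (T : Filling g r m n) →
             #boxes P? T ≡ sum λ i → count λ j → P? (T i j)
#boxes≡sum {m = m} {n = n} P? T = length-filter-grid {m} {n} _ id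

-- L-tableaux as profiles

-- In the total order that puts every red letter below every blue one, an
-- L-tableau is weakly increasing along both rows and columns.
rank : Entry g r → ℕ
rank     (red k)  = toℕ k
rank {g} (blue c) = g + toℕ c

rank< : (e : Entry g r) → rank e < g + suc r
rank< {g} (red k)  = ≤-trans (toℕ<n k) (m≤m+n g _)
rank< {g} (blue c) = +-monoʳ-< g (toℕ<n c)

red-rank< : {e : Entry g r} → IsRed e → rank e < g
red-rank< (k , refl) = toℕ<n k

rank<⇒red : (e : Entry g r) → rank e < g → IsRed e
rank<⇒red (red k)  _ = k , refl
rank<⇒red {g} (blue c) lt = contradiction lt (≤⇒≯ (m≤m+n g _))

rank-injective : {e e′ : Entry g r} → rank e ≡ rank e′ → e ≡ e′
rank-injective     {e = red _}  {red _}  eq = cong red (toℕ-injective eq)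
rank-injective {g} {e = blue _} {blue _} eq = cong blue (toℕ-injective (+-cancelˡ-≡ g _ _ eq))
rank-injective {g} {e = red k}  {blue _} eq =
  contradiction (subst (_< g) eq (toℕ<n k)) (≤⇒≯ (m≤m+n g _))
rank-injective {g} {e = blue _} {red k}  eq =
  contradiction (subst (_< g) (sym eq) (toℕ<n k)) (≤⇒≯ (m≤m+n g _))

rank-surjective : ∀ v → v < g + suc r → ∃ λ (e : Entry g r) → rank e ≡ v
rank-surjective {g} {r} v v< with v <? g
... | yes v<g = red (fromℕ< v<g) , toℕ-fromℕ< v<g
... | no  v≮g = blue (fromℕ< c<) , trans (cong (g +_) (toℕ-fromℕ< c<)) (m+[n∸m]≡n (≮⇒≥ v≮g))
  where
  c< : v ∸ g < suc r
  c< = +-cancelˡ-< g _ _ (subst (_< g + suc r) (sym (m+[n∸m]≡n (≮⇒≥ v≮g))) v<)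

-- Row i has letters of rank ≥ ℓ
-- exactly in its last M ℓ i boxes; in this form no subtraction from n is needed.
Represents : Filling g r (suc r) n → (ℕ → Fin (suc r) → ℕ) → Set
Represents {n = n} T M = ∀ i j ℓ → ℓ ≤ rank (T i j) ⇔ n ≤ toℕ j + M ℓ i

represents-unique : {T : Filling g r (suc r) n} {M M′ : ℕ → Fin (suc r) → ℕ} →
  Represents T M → Represents T M′ → (∀ ℓ i → M ℓ i ≤ n) → (∀ ℓ i → M′ ℓ i ≤ n) →
  ∀ ℓ i → M ℓ i ≡ M′ ℓ i
represents-unique rep rep′ M≤n M′≤n ℓ i = ≤-antisym
  (threshold-≤ (M≤n ℓ i) λ j → to (rep′ i j ℓ) ∘ from (rep i j ℓ))
  (threshold-≤ (M′≤n ℓ i) λ j → to (rep i j ℓ) ∘ from (rep′ i j ℓ))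
  where open Equivalence

module _ (T : Filling g r (suc r) n) where

  rankCount : ℕ → Fin (suc r) → ℕ
  rankCount ℓ i = count λ j → ℓ ≤? rank (T i j)

  rankCount≤n : ∀ ℓ i → rankCount ℓ i ≤ n
  rankCount≤n ℓ i = count≤n λ j → ℓ ≤? rank (T i j)

  rankCount-represents : (∀ {i j j′} → j Fin.≤ j′ → rank (T i j) ≤ rank (T i j′)) →
                         Represents T rankCount
  rankCount-represents rows i j ℓ =
    count-upward (λ j → ℓ ≤? rank (T i j)) (λ j≤j′ le → ≤-trans le (rows j≤j′)) j

  rowContent : Fin g → Fin (suc r) → ℕ
  rowContent k i = count λ j → ≡red? k (T i j)

  -- A rank at least `toℕ k` is either equal to it, which means that the letter is `red k`, or
  -- larger. Steps of a profile thereby measure how often a red letter occurs in a row.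
  rowContent-rankCount : ∀ k i → rankCount (toℕ k) i ≡ rowContent k i + rankCount (suc (toℕ k)) i
  rowContent-rankCount k i = trans (sum-cong-≗ λ j → split (T i j))
    (∑-distrib-+ (λ j → 𝟙 (does (≡red? k (T i j)))) (λ j → 𝟙 (does (suc (toℕ k) ≤? rank (T i j)))))
    where
    split : ∀ e → 𝟙 (does (toℕ k ≤? rank e)) ≡ 𝟙 (does (≡red? k e)) + 𝟙 (does (suc (toℕ k) ≤? rank e))
    split e with <-cmp (toℕ k) (rank e)
    ... | tri< k<e k≢e _ = trans (𝟙-yes (toℕ k ≤? rank e) (<⇒≤ k<e))
      (sym (cong₂ _+_ (𝟙-no (≡red? k e) λ { refl → k≢e refl }) (𝟙-yes (suc (toℕ k) ≤? rank e) k<e)))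
    ... | tri≈ k≮e k≡e _ = trans (𝟙-yes (toℕ k ≤? rank e) (≤-reflexive k≡e))
      (sym (cong₂ _+_ (𝟙-yes (≡red? k e) (rank-injective (sym k≡e))) (𝟙-no (suc (toℕ k) ≤? rank e) k≮e)))
    ... | tri> k≮e k≢e e<k = trans (𝟙-no (toℕ k ≤? rank e) (<⇒≱ e<k))
      (sym (cong₂ _+_ (𝟙-no (≡red? k e) λ { refl → k≢e refl }) (𝟙-no (suc (toℕ k) ≤? rank e) k≮e)))

sum-indicator : (l : Fin n) → sum (λ k → 𝟙 (does (l ≟ k))) ≡ 1
sum-indicator {suc n} zero    = cong suc (trans (sum-const n 0) (*-zeroʳ n))
sum-indicator         (suc l) = sum-indicator l

module _ (T : Filling g r (suc r) n) (content : ∀ k → #boxes (≡red? k) T ≡ r) where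

  -- Counts the red boxes letter by letter: after interchanging the sums, each of the `g` letters
  -- contributes `r`.
  #red-from-content : #boxes isRed? T ≡ r * g
  #red-from-content = begin
    #boxes isRed? T
      ≡⟨ #boxes≡sum isRed? T ⟩
    (sum λ i → sum λ j → 𝟙 (does (isRed? (T i j))))
      ≡⟨ sum-cong-≗ (λ i → sum-cong-≗ λ j → by-letter (T i j)) ⟩
    (sum λ i → sum λ j → sum λ k → 𝟙 (does (≡red? k (T i j))))
      ≡⟨ sum-cong-≗ (λ i → ∑-comm λ j k → 𝟙 (does (≡red? k (T i j)))) ⟩
    (sum λ i → sum λ k → rowContent T k i)
      ≡⟨ ∑-comm (λ i k → rowContent T k i) ⟩
    (sum λ k → sum (rowContent T k))
      ≡⟨ sum-cong-≗ (λ k → trans (sym (#boxes≡sum (≡red? k) T)) (content k)) ⟩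
    sum {g} (λ _ → r)
      ≡⟨ sum-const g r ⟩
    g * r
      ≡⟨ *-comm g r ⟩
    r * g ∎
    where
    open ≡-Reasoning
    by-letter : (e : Entry g r) → 𝟙 (does (isRed? e)) ≡ sum λ k → 𝟙 (does (≡red? k e))
    by-letter (red l)  = sym (sum-indicator l)
    by-letter (blue _) = sym (trans (sum-const g 0) (*-zeroʳ g))

  #blue-from-content : #boxes isBlue? T ≡ n * suc r ∸ r * g
  #blue-from-content = begin
    #boxes isBlue? T
      ≡⟨ m+n∸n≡m _ (r * g) ⟨
    #boxes isBlue? T + r * g ∸ r * g
      ≡⟨ cong (λ k → #boxes isBlue? T + k ∸ r * g) #red-from-content ⟨
    #boxes isBlue? T + #boxes isRed? T ∸ r * g
      ≡⟨ cong (_∸ r * g) total ⟩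
    n * suc r ∸ r * g ∎
    where
    open ≡-Reasoning
    colour : (e : Entry g r) → 𝟙 (does (isBlue? e)) + 𝟙 (does (isRed? e)) ≡ 1
    colour (red _)  = refl
    colour (blue _) = refl
    total : #boxes isBlue? T + #boxes isRed? T ≡ n * suc r
    total = begin
      #boxes isBlue? T + #boxes isRed? T
        ≡⟨ cong₂ _+_ (#boxes≡sum isBlue? T) (#boxes≡sum isRed? T) ⟩
      (sum λ i → count λ j → isBlue? (T i j)) + (sum λ i → count λ j → isRed? (T i j))
        ≡⟨ ∑-distrib-+ (λ i → count λ j → isBlue? (T i j)) (λ i → count λ j → isRed? (T i j)) ⟨
      (sum λ i → (count λ j → isBlue? (T i j)) + (count λ j → isRed? (T i j)))
        ≡⟨ sum-cong-≗ (λ i → trans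
             (sym (∑-distrib-+ (λ j → 𝟙 (does (isBlue? (T i j)))) (λ j → 𝟙 (does (isRed? (T i j))))))
             (trans (sum-cong-≗ λ j → colour (T i j)) (trans (sum-const n 1) (*-identityʳ n)))) ⟩
      sum {suc r} (λ _ → n)
        ≡⟨ sum-const (suc r) n ⟩
      suc r * n
        ≡⟨ *-comm (suc r) n ⟩
      n * suc r ∎

open IsLTableau
open Equivalence

-- From L-tableaux to profiles

module FromTableau {d : ℕ} {T : Filling g r (suc r) (d ∸ r)} (lt : IsLTableau g r d T) where

  rows : ∀ {i j j′} → j Fin.≤ j′ → rank (T i j) ≤ rank (T i j′)
  rows {i} {j} {j′} j≤j′ with m≤n⇒m<n∨m≡n j≤j′
  ... | inj₂ j≡j′ = ≤-reflexive (cong (rank ∘ T i) (toℕ-injective j≡j′))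
  ... | inj₁ j<j′ with T i j in e | T i j′ in e′
  ...   | red k  | red l  = <⇒≤ (red-rows lt j<j′ e e′)
  ...   | red k  | blue b = ≤-trans (<⇒≤ (toℕ<n k)) (m≤m+n g _)
  ...   | blue a | blue b = +-monoʳ-≤ g (blue-rows lt j<j′ e e′)
  -- A red letter to the right of a blue one contradicts `red-justified`.
  ...   | blue a | red l  with _ , e″ ← red-justified lt {i} {i} ≤-refl j≤j′ (l , e′)
                          with () ← trans (sym e) e″

  blue-columns-strict : ∀ {i i′ j} → i Fin.< i′ → g ≤ rank (T i j) → rank (T i j) < rank (T i′ j)
  blue-columns-strict {i} {i′} {j} i<i′ g≤ with T i j in e | T i′ j in e′
  ... | red k  | _      = contradiction g≤ (<⇒≱ (toℕ<n k))
  ... | blue a | blue b = +-monoʳ-< g (blue-columns lt i<i′ e e′)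
  ... | blue a | red l  with _ , e″ ← red-justified lt {j′ = j} (<⇒≤ i<i′) ≤-refl (l , e′)
                        with () ← trans (sym e) e″

  columns : ∀ {i i′ j} → i Fin.≤ i′ → rank (T i j) ≤ rank (T i′ j)
  columns {i} {i′} {j} i≤i′ with m≤n⇒m<n∨m≡n i≤i′
  ... | inj₂ i≡i′ = ≤-reflexive (cong (λ i → rank (T i j)) (toℕ-injective i≡i′))
  ... | inj₁ i<i′ with g ≤? rank (T i j)
  ...   | yes g≤ = <⇒≤ (blue-columns-strict i<i′ g≤)
  ...   | no  g≰ with g ≤? rank (T i′ j)
  ...     | yes g≤ = ≤-trans (<⇒≤ (≰⇒> g≰)) g≤
  ...     | no  g≰′ with k , e ← rank<⇒red (T i j) (≰⇒> g≰) | l , e′ ← rank<⇒red (T i′ j) (≰⇒> g≰′)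
    rewrite e | e′ = red-columns lt i<i′ e e′

  represents : Represents T (rankCount T)
  represents = rankCount-represents T rows

  rankCount-≤ : ∀ {ℓ ℓ′ i i′} → (∀ j → ℓ ≤ rank (T i j) → ℓ′ ≤ rank (T i′ j)) →
                rankCount T ℓ i ≤ rankCount T ℓ′ i′
  rankCount-≤ {ℓ} {ℓ′} {i} {i′} imp = threshold-≤ (rankCount≤n T ℓ i) λ j →
    to (represents i′ j ℓ′) ∘ imp j ∘ from (represents i j ℓ)

  rowContent≤1 : ∀ k i → rowContent T k i ≤ 1
  rowContent≤1 k i = count≤1 (λ j → ≡red? k (T i j)) unique
    where
    unique : ∀ {j j′} → T i j ≡ red k → T i j′ ≡ red k → j ≡ j′
    unique {j} {j′} e e′ with <-cmp (toℕ j) (toℕ j′)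
    ... | tri< j<j′ _ _ = contradiction (red-rows lt j<j′ e e′) (n≮n _)
    ... | tri≈ _ j≡j′ _ = toℕ-injective j≡j′
    ... | tri> _ _ j′<j = contradiction (red-rows lt j′<j e′ e) (n≮n _)

  -- Row strictness bounds each `rowContent` by one, and `red-content` makes them sum to `r` over
  -- `r + 1` rows; the row left out is `w`.
  omitted-row : ∀ k → let M = rankCount T in ∃ λ w →
    M (toℕ k) w ≡ M (suc (toℕ k)) w × (∀ i → i ≢ w → M (toℕ k) i ≡ suc (M (suc (toℕ k)) i))
  omitted-row k
    with w , none , once ← sum⇒all-one-except (rowContent T k) (rowContent≤1 k)
           (trans (sym (#boxes≡sum (≡red? k) T)) (red-content lt k)) =
    w , step w none , λ i i≢w → step i (once i i≢w)
    where
    step : ∀ {c} i → rowContent T k i ≡ c →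
           rankCount T (toℕ k) i ≡ c + rankCount T (suc (toℕ k)) i
    step i refl = rowContent-rankCount T k i

  isProfile : IsProfile g (rankCount T)
  isProfile = record
    { end = λ i → count-none (λ j → _ ≤? rank (T i j)) λ j → <⇒≱ (rank< (T i j))
    ; antitone = λ ℓ i → rankCount-≤ λ j → ≤-trans (n≤1+n ℓ)
    ; red-step = λ ℓ<g → subst
        (λ ℓ → ∃ λ w → rankCount T ℓ w ≡ rankCount T (suc ℓ) w ×
                       (∀ i → i ≢ w → rankCount T ℓ i ≡ suc (rankCount T (suc ℓ) i)))
        (toℕ-fromℕ< ℓ<g) (omitted-row (fromℕ< ℓ<g))
    ; red-increasing = λ {ℓ} _ i≤i′ → rankCount-≤ {ℓ} {ℓ} λ j le → ≤-trans le (columns i≤i′)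
    -- A letter of rank at least `ℓ ≥ g` is blue, so the box of row `i′` in the same column has rank
    -- at least `suc ℓ`.
    ; blue-increasing = λ g≤ℓ i<i′ → rankCount-≤ λ j le →
        ≤-trans (s≤s le) (blue-columns-strict i<i′ (≤-trans g≤ℓ le))
    }

  start : ∀ i → rankCount T 0 i ≡ d ∸ r
  start i = count-all (λ j → 0 ≤? rank (T i j)) λ _ → z≤n

-- From profiles to L-tableaux

module ToTableau (d : ℕ) {M : ℕ → Fin (suc r) → ℕ} (pr : IsProfile g M)
                 (start : ∀ i → M 0 i ≡ d ∸ r) where

  profile≤ : ∀ ℓ i → M ℓ i ≤ d ∸ r
  profile≤ zero    i = ≤-reflexive (start i)
  profile≤ (suc ℓ) i = ≤-trans (antitone pr ℓ i) (profile≤ ℓ i)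

  -- The rank of a box is the greatest level `ℓ` whose final segment, of length `M ℓ i`, contains
  -- it. Level 0 always does, as the row is full by `start`; level `g + suc r` never does, by `end`.
  entry-rank : ∀ i (j : Fin (d ∸ r)) →
    ∃ λ v → v < g + suc r × (∀ ℓ → ℓ ≤ v ⇔ d ∸ r ≤ toℕ j + M ℓ i)
  entry-rank i j = downward-maximum (g + suc r) (λ ℓ → d ∸ r ≤? toℕ j + M ℓ i)
    (λ {ℓ} le → ≤-trans le (+-monoʳ-≤ (toℕ j) (antitone pr ℓ i)))
    (≤-trans (≤-reflexive (sym (start i))) (m≤n+m _ (toℕ j)))
    (λ le → <⇒≱ (toℕ<n j) (≤-trans le
      (≤-reflexive (trans (cong (toℕ j +_) (end pr i)) (+-identityʳ _)))))

  entry : ∀ i j → ∃ λ (e : Entry g r) → rank e ≡ proj₁ (entry-rank i j)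
  entry i j = rank-surjective _ (proj₁ (proj₂ (entry-rank i j)))

  tableau : Filling g r (suc r) (d ∸ r)
  tableau i j = proj₁ (entry i j)

  represents : Represents tableau M
  represents i j ℓ rewrite proj₂ (entry i j) = proj₂ (proj₂ (entry-rank i j)) ℓ

  rows : ∀ {i j j′} → j Fin.≤ j′ → rank (tableau i j) ≤ rank (tableau i j′)
  rows {i} {j} {j′} j≤j′ = from (represents i j′ _)
    (≤-trans (to (represents i j _) ≤-refl) (+-monoˡ-≤ _ j≤j′))

  blue-columns-strict : ∀ {i i′ j} → i Fin.< i′ → g ≤ rank (tableau i j) →
                        rank (tableau i j) < rank (tableau i′ j)
  blue-columns-strict {i} {i′} {j} i<i′ g≤ = from (represents i′ j _)
    (≤-trans (to (represents i j _) ≤-refl) (+-monoʳ-≤ (toℕ j) (blue-increasing pr g≤ i<i′)))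

  columns : ∀ {i i′ j} → i Fin.≤ i′ → rank (tableau i j) ≤ rank (tableau i′ j)
  columns {i} {i′} {j} i≤i′ with ≤-total g (rank (tableau i j)) | m≤n⇒m<n∨m≡n i≤i′
  ... | _       | inj₂ i≡i′ =
    ≤-reflexive (cong (λ i → rank (tableau i j)) (toℕ-injective i≡i′))
  ... | inj₁ g≤ | inj₁ i<i′ = <⇒≤ (blue-columns-strict i<i′ g≤)
  ... | inj₂ ≤g | inj₁ _    = from (represents i′ j _)
    (≤-trans (to (represents i j _) ≤-refl) (+-monoʳ-≤ (toℕ j) (red-increasing pr ≤g i≤i′)))

  -- Passing a red level shortens the final segment by at most one box, while moving right gains at
  -- least one.
  red-rows-strict : ∀ {i j j′} → j Fin.< j′ → rank (tableau i j) < g →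
                    rank (tableau i j) < rank (tableau i j′)
  red-rows-strict {i} {j} {j′} j<j′ <g = from (represents i j′ _) (begin
    d ∸ r                      ≤⟨ to (represents i j ℓ) ≤-refl ⟩
    toℕ j + M ℓ i              ≤⟨ +-monoʳ-≤ (toℕ j) step ⟩
    toℕ j + suc (M (suc ℓ) i)  ≡⟨ +-suc (toℕ j) _ ⟩
    suc (toℕ j) + M (suc ℓ) i  ≤⟨ +-monoˡ-≤ _ j<j′ ⟩
    toℕ j′ + M (suc ℓ) i       ∎)
    where
    open ≤-Reasoning
    ℓ = rank (tableau i j)
    step : M ℓ i ≤ suc (M (suc ℓ) i)
    step with red-step pr <g
    ... | w , at-w , off-w with i ≟ w
    ...   | yes refl = ≤-trans (≤-reflexive at-w) (n≤1+n _)
    ...   | no  i≢w  = ≤-reflexive (off-w i i≢w)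

  rankCount≗ : ∀ ℓ i → rankCount tableau ℓ i ≡ M ℓ i
  rankCount≗ = represents-unique {T = tableau} (rankCount-represents tableau rows) represents
    (rankCount≤n tableau) profile≤

  content : ∀ k → #boxes (≡red? k) tableau ≡ r
  content k with red-step pr (toℕ<n k)
  ... | w , at-w , off-w = trans (#boxes≡sum (≡red? k) tableau)
    -- Comparing `step` with the equations of `red-step` gives content 0 in row `w` and 1 in every
    -- other row, hence `r` in total.
    (all-one-except⇒sum (rowContent tableau k) w (+-cancelʳ-≡ _ _ 0 (trans (sym (step w)) at-w))
      λ i i≢w → +-cancelʳ-≡ _ _ 1 (trans (sym (step i)) (off-w i i≢w)))
    where
    step : ∀ i → M (toℕ k) i ≡ rowContent tableau k i + M (suc (toℕ k)) i
    step i = trans (sym (rankCount≗ (toℕ k) i)) (trans (rowContent-rankCount tableau k i)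
      (cong (rowContent tableau k i +_) (rankCount≗ (suc (toℕ k)) i)))

  isLTableau : IsLTableau g r d tableau
  isLTableau = record
    { #red = #red-from-content tableau content
    ; #blue = #blue-from-content tableau content
    ; red-justified = λ i′≤i j′≤j isRed →
        rank<⇒red _ (≤-<-trans (≤-trans (columns i′≤i) (rows j′≤j)) (red-rank< isRed))
    ; red-columns = λ {i} {i′} {j} i<i′ e e′ →
        subst₂ _≤_ (cong rank e) (cong rank e′) (columns {i} {i′} {j} (<⇒≤ i<i′))
    ; red-rows = λ {i} {j} {j′} j<j′ e e′ →
        subst₂ _<_ (cong rank e) (cong rank e′) (red-rows-strict {i} {j} {j′} j<j′ (red-rank< (_ , e)))
    ; red-content = content
    ; blue-columns = λ {i} {i′} {j} i<i′ e e′ → +-cancelˡ-< g _ _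
        (subst₂ _<_ (cong rank e) (cong rank e′) (blue-columns-strict {i} {i′} {j} i<i′
          (≤-trans (m≤m+n g _) (≤-reflexive (sym (cong rank e))))))
    ; blue-rows = λ {i} {j} {j′} j<j′ e e′ → +-cancelˡ-≤ g _ _
        (subst₂ _≤_ (cong rank e) (cong rank e′) (rows {i} {j} {j′} (<⇒≤ j<j′)))
    }

-- The bijection between words and L-tableaux

module Enumeration (g r d : ℕ) (g+r≤d : g + r ≤ d) where

  κ = d ∸ r ∸ g
  c₀ = replicate (suc r) κ

  c₀-increasing : Increasing c₀
  c₀-increasing = GT⇒increasing c₀ (GT-constant κ)

  -- Here `g + r ≤ d` enters: it makes the subtraction in `κ` exact, so that every row starts with
  -- `d ∸ r` boxes.
  c₀+g : ∀ i → lookup c₀ i + g ≡ d ∸ r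
  c₀+g i = trans (cong (_+ g) (lookup-replicate i κ)) (m∸n+n≡m (m+n≤o⇒m≤o∸n g g+r≤d))

  isProfile : (x : Chain g c₀) → IsProfile g (profile g c₀ x)
  isProfile x = profile-isProfile g c₀ x c₀-increasing

  start : (x : Chain g c₀) → ∀ i → profile g c₀ x 0 i ≡ d ∸ r
  start x i = trans (profile-start g c₀ x i) (c₀+g i)

  module ChainTableau (x : Chain g c₀) = ToTableau d (isProfile x) (start x)

  chain-words : Fin ((r + 1) ^ g) ↔ Chain g c₀
  chain-words rewrite +-comm r 1 = ↔-sym (↔-trans (chain-count g c₀ c₀-increasing)
    (mk↔ₛ′ proj₁ (_, GT-constant κ) (λ _ → refl)
      (λ (q , t) → cong (q ,_) (GT-constant-unique κ _ t))))

  -- The tableau determines its profile by `represents-unique`, and the profile determines the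
  -- chain.
  chainTableau-injective : ∀ {x x′} → (∀ i j → ChainTableau.tableau x i j ≡ ChainTableau.tableau x′ i j) → x ≡ x′
  chainTableau-injective {x} {x′} eq = profile-injective g c₀ (represents-unique {T = ChainTableau.tableau x}
    (ChainTableau.represents x)
    (λ i j ℓ → subst (λ e → ℓ ≤ rank e ⇔ d ∸ r ≤ toℕ j + profile g c₀ x′ ℓ i)
                 (sym (eq i j)) (ChainTableau.represents x′ i j ℓ))
    (ChainTableau.profile≤ x) (ChainTableau.profile≤ x′))

  -- The chain comes from the profile of `T`; the two tableaux then have equal thresholds, hence
  -- equal ranks, at every box.
  chainTableau-surjective : ∀ {T} → IsLTableau g r d T → ∃ λ x → ∀ i j → ChainTableau.tableau x i j ≡ T i j
  chainTableau-surjective {T} lt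
    with x , eq ← profile-surjective g c₀ (FromTableau.isProfile lt)
           (λ i → trans (FromTableau.start lt i) (sym (c₀+g i))) =
    x , λ i j → rank-injective (≤-antisym
      (from (FromTableau.represents lt i j _)
        (subst (λ t → d ∸ r ≤ toℕ j + t) (eq _ i) (to (ChainTableau.represents x i j _) ≤-refl)))
      (from (ChainTableau.represents x i j _)
        (subst (λ t → d ∸ r ≤ toℕ j + t) (sym (eq _ i)) (to (FromTableau.represents lt i j _) ≤-refl))))

theorem1p3 : (g r d : ℕ) → 1 ≤ r → g + r ≤ d → HasCardinality (LTableau g r d) ((r + 1) ^ g)
theorem1p3 g r d _ g+r≤d = record
  { to        = λ q → ChainTableau.tableau (Inverse.to words q) , ChainTableau.isLTableau (Inverse.to words q)
  ; cong      = λ { refl _ _ → refl }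
  ; bijective =
      (λ eq → Injection.injective (Inverse⇒Injection words) (chainTableau-injective eq)) ,
      λ (T , lt) → let x , x≈T = chainTableau-surjective lt in
        Inverse.from words x , λ { refl i j →
          trans (cong (λ x → ChainTableau.tableau x i j) (Inverse.strictlyInverseˡ words x)) (x≈T i j) }
  }
  where
  open Enumeration g r d g+r≤d
  words = chain-words
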